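{- Let $n,i,j\ge0$, $k\ge3$ be integers and $m\in\{1,2\}$. The number of partitions counted by $A^k_m(n)$ that have exactly $i$ parts $\equiv 3-m\pmod k$ and exactly $j$ parts $\equiv m\pmod k$ equals the number of partitions counted by $C^k_m(n)$ that have exactly $i$ parts $\equiv 3-m\pmod{2k}$ and exactly $j$ parts $\equiv k+m\pmod{2k}$. In particular $A^k_m(n)=C^k_m(n)$.
   Context: A partition is $k$-strict if for every $m'\in\mathbb{N}$ and all $1\le r_1\le r_2\le k-1$, the numbers $m'k+r_1$ and $m'k+r_2$ do not appear together as parts. For a partition $\pi=(\pi_1\ge\pi_2\ge\cdots)$, the odd-indexed parts are $\pi_1,\pi_3,\dots$ and the even-indexed parts are $\pi_2,\pi_4,\dots$. $A^k_m(n)$ is the number of $k$-strict partitions of $n$ such that (i) no part is repeated, (ii) every odd-indexed part is $\equiv k$ or $\equiv 3-m\pmod k$, (iii) every even-indexed part is $\equiv k$ or $\equiv m\pmod k$. $C^k_m(n)$ is the number of partitions of $n$ into distinct parts each congruent to $3-m$, $k$, $k+m$ or $2k$ modulo $2k$. -}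

module Defs where

open import Data.Nat using (ℕ; zero; suc; _+_; _*_; _∸_; _%_; _/_; _≡ᵇ_; _<ᵇ_)
open import Data.Bool using (Bool; true; false; _∧_; _∨_; not; T)
open import Data.List using (List; []; _∷_; length; filter)
open import Data.Nat.ListAction using (sum)
open import Data.Product using (Σ)
open import Relation.Binary.PropositionalEquality using (_≡_)

-- A partition of n is represented by the list of its parts in weakly
-- decreasing order  π₁ ≥ π₂ ≥ ⋯ , all parts positive.
-- For partitions into distinct parts (the only ones counted below) the
-- list is strictly decreasing.

-- residue and quotient; the modulus is always ≥ 3 in the theorem, the
-- zero case is only there to make the functions total
_mod_ : ℕ → ℕ → ℕ
a mod zero = a
a mod suc k = a % suc k

_div_ : ℕ → ℕ → ℕ
a div zero = 0
a div suc k = a / suc k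

strictDecr : List ℕ → Bool
strictDecr [] = true
strictDecr (a ∷ []) = 0 <ᵇ a
strictDecr (a ∷ b ∷ l) = (b <ᵇ a) ∧ strictDecr (b ∷ l)

allB : (ℕ → Bool) → List ℕ → Bool
allB p [] = true
allB p (a ∷ l) = p a ∧ allB p l

countB : (ℕ → Bool) → List ℕ → ℕ
countB p l = length (filter (λ a → T? (p a)) l)
  where
  open import Relation.Nullary.Decidable using (Dec; yes; no)
  T? : (b : Bool) → Dec (T b)
  T? true = yes _
  T? false = no (λ ())

-- k-strictness: there are no two parts m'k+r₁ and m'k+r₂ with
-- 1 ≤ r₁ < r₂ ≤ k-1, i.e. no two different parts, both not divisible by k,
-- with the same quotient by k.  (The case r₁ = r₂ would concern repeated
-- parts, which are excluded separately by condition (i).)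
clash : ℕ → ℕ → ℕ → Bool
clash k a b = not (a ≡ᵇ b) ∧ not ((a mod k) ≡ᵇ 0) ∧ not ((b mod k) ≡ᵇ 0)
              ∧ ((a div k) ≡ᵇ (b div k))

kStrict : ℕ → List ℕ → Bool
kStrict k [] = true
kStrict k (a ∷ l) = allB (λ b → not (clash k a b)) l ∧ kStrict k l

-- a ≡ r (mod q)   (r < q in all uses)
congB : ℕ → ℕ → ℕ → Bool
congB q r a = (a mod q) ≡ᵇ r

oddEvenCond : ℕ → ℕ → List ℕ → Bool
oddEvenCond k m [] = true
oddEvenCond k m (a ∷ []) = congB k 0 a ∨ congB k (3 ∸ m) a
oddEvenCond k m (a ∷ b ∷ l) =
  (congB k 0 a ∨ congB k (3 ∸ m) a) ∧ (congB k 0 b ∨ congB k m b)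
  ∧ oddEvenCond k m l

isA : ℕ → ℕ → ℕ → List ℕ → Bool
isA k m n π = strictDecr π ∧ (sum π ≡ᵇ n) ∧ kStrict k π ∧ oddEvenCond k m π

isC : ℕ → ℕ → ℕ → List ℕ → Bool
isC k m n π = strictDecr π ∧ (sum π ≡ᵇ n)
  ∧ allB (λ a → congB (2 * k) (3 ∸ m) a ∨ congB (2 * k) k a
                ∨ congB (2 * k) (k + m) a ∨ congB (2 * k) 0 a) π

Aset : (k m n i j : ℕ) → Set
Aset k m n i j = Σ (List ℕ) λ π →
  T (isA k m n π ∧ (countB (congB k (3 ∸ m)) π ≡ᵇ i)
                 ∧ (countB (congB k m) π ≡ᵇ j))

Cset : (k m n i j : ℕ) → Set
Cset k m n i j = Σ (List ℕ) λ π →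
  T (isC k m n π ∧ (countB (congB (2 * k) (3 ∸ m)) π ≡ᵇ i)
                 ∧ (countB (congB (2 * k) (k + m)) π ≡ᵇ j))

AsetAll : (k m n : ℕ) → Set
AsetAll k m n = Σ (List ℕ) λ π → T (isA k m n π)

CsetAll : (k m n : ℕ) → Set
CsetAll k m n = Σ (List ℕ) λ π → T (isC k m n π)

-- Both kinds of partition are strictly decreasing words in the parts
-- q k + (residue) and (q + 1) k, of weights q and q + 1; they differ only in how
-- the residue of a coloured part is chosen: by the parity of its position (A) or
-- by the parity of q (C).  Let F(x, y) be the generating function of either kind,
-- z marking the weight and x, y the coloured parts with residue 3 - m and m.
-- Both satisfy F(x, y) = (1 + x) F(yz, xz).  For C this splits off the part with
-- q = 0.  For A, let a transfer matrix read the letters in blocks from the top,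
-- with the parity of the position as state.  Blocks (coloured q+1, plain q+1) give
--     N = [[1 + x z^(2q+2), z^(q+1) (1 + x)], [z^(q+1) (1 + y), 1 + y z^(2q+2)]],
-- while for (yz, xz) the blocks (plain q+1, coloured q) give the transpose of N,
-- which is conjugate to N by diag(1/(1 + x), 1/(1 + y)).  Bijectively: the bits
-- saying which of the letters alone in their block are coloured shift by one
-- place.  Iterating the functional equation converts one kind into the other.
module Submission where

open import Defs
open import Data.Nat
open import Data.Nat.Properties
open import Data.Nat.Solver using (module +-*-Solver)
open +-*-Solver using (solve; con; _:+_; _:*_; _:=_)
open import Data.Nat.DivMod
  using (m≡m%n+[m/n]*n; m%n<n; [m+kn]%n≡m%n; m*n%n≡0; m<n⇒m%n≡m; m<n⇒m/n≡0; m*n/n≡m; +-distrib-/-∣ʳ; /-monoˡ-≤)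
open import Data.Nat.Divisibility using (divides)
open import Data.Nat.ListAction using (sum)
open import Data.Bool using (Bool; true; false; _∧_; _∨_; not; T; if_then_else_)
open import Data.List using (List; []; _∷_; map)
open import Data.Sum using (_⊎_; inj₁; inj₂)
open import Data.Product using (_×_; _,_; proj₁; proj₂; Σ)
open import Data.Unit using (⊤; tt)
open import Function.Bundles using (_↔_; mk↔ₛ′; Equivalence)
open Equivalence using (to; from)
open import Data.Bool.Properties using (T-∧; T-∨; T-≡; T-irrelevant)
open import Algebra.Properties.CommutativeSemigroup +-commutativeSemigroup using (x∙yz≈y∙xz)
open import Relation.Nullary.Decidable using (dec-true; dec-false)
open import Relation.Nullary using (yes; no; contradiction)
open import Relation.Binary.PropositionalEquality

-- Letters, and words of bits as sets of letters.

-- col q is the coloured part of quotient q, pl q the multiple (q + 1) k, so that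
-- col 0 < pl 0 < col 1 < pl 1 < ⋯ whatever the residues are.
data Letter : Set where
  col pl : ℕ → Letter

-- Characteristic sequences of sets of letters, largest letter first: the bit in
-- front of an Even word of length 2q stands for col q, the bit in front of an Odd
-- word of length 2q + 1 for pl q.
mutual
  data Even : Set where
    []  : Even
    _∷_ : Bool → Odd → Even

  data Odd : Set where
    _∷_ : Bool → Even → Odd

mutual
  heightE : Even → ℕ
  heightE []      = 0
  heightE (_ ∷ o) = suc (heightO o)

  heightO : Odd → ℕ
  heightO (_ ∷ e) = heightE e

mutual
  lettersE : Even → List Letter
  lettersE []          = []
  lettersE (true ∷ o)  = pl (heightO o) ∷ lettersO o
  lettersE (false ∷ o) = lettersO o

  lettersO : Odd → List Letter
  lettersO (true ∷ e)  = col (heightE e) ∷ lettersE e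
  lettersO (false ∷ e) = lettersE e

-- Each round of the conversion raises the height by one, so words are compared only up to empty
-- blocks on top.
pad : Odd → Odd
pad o = false ∷ (false ∷ o)

pads : ℕ → Odd → Odd
pads zero    o = o
pads (suc j) o = pad (pads j o)

letters-pads : ∀ j o → lettersO (pads j o) ≡ lettersO o
letters-pads zero    o = refl
letters-pads (suc j) o = letters-pads j o

-- Weights and colour statistics.

weight : List Letter → ℕ
weight []          = 0
weight (col q ∷ w) = q + weight w
weight (pl q ∷ w)  = suc q + weight w

ind : Bool → ℕ
ind true  = 1
ind false = 0

sameB : Bool → Bool → Bool
sameB true  b = b
sameB false b = not b

coloured : List Letter → ℕ
coloured []          = 0
coloured (col _ ∷ w) = suc (coloured w)
coloured (pl _ ∷ w)  = coloured w

-- Chooses the residue class of a coloured letter from the parity of its position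
-- (true for odd positions) and its quotient.
Hue : Set
Hue = Bool → ℕ → Bool

-- `b` is the colour being counted, `st` the parity of the position at which the list begins.
tally : Hue → Bool → Bool → List Letter → ℕ
tally χ b st []          = 0
tally χ b st (col q ∷ w) = ind (sameB b (χ st q)) + tally χ b (not st) w
tally χ b st (pl q ∷ w)  = tally χ b (not st) w

tally-sum : ∀ χ st w → tally χ true st w + tally χ false st w ≡ coloured w
tally-sum χ st []          = refl
tally-sum χ st (pl q ∷ w)  = tally-sum χ (not st) w
tally-sum χ st (col q ∷ w) with χ st q
... | true  = cong suc (tally-sum χ (not st) w)
... | false = trans (+-suc _ _) (cong suc (tally-sum χ (not st) w))

-- The functional equation as a bijection.

-- split realises F(x, y) = (1 + x) F(yz, xz): colour true is x, and every
-- coloured letter loses one unit of weight and has its colour exchanged.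
record Colouring : Set where
  field
    hue          : Hue
    split        : Odd → Bool × Even
    join         : Bool → Even → Odd
    join-split   : ∀ o → join (proj₁ (split o)) (proj₂ (split o)) ≡ o
    split-join   : ∀ b e → split (join b e) ≡ (b , e)
    split-pad    : ∀ o → split (pad o) ≡ (proj₁ (split o) , false ∷ (false ∷ proj₂ (split o)))
    join-pad     : ∀ b e → join b (false ∷ (false ∷ e)) ≡ pad (join b e)
    height-split : ∀ o → heightE (proj₂ (split o)) ≡ heightO o
    tally-split  : ∀ b o → tally hue b true (lettersO o)
                   ≡ ind (proj₁ (split o) ∧ b) + tally hue (not b) true (lettersE (proj₂ (split o)))
    weight-split : ∀ o → weight (lettersO o)
                   ≡ weight (lettersE (proj₂ (split o))) + coloured (lettersE (proj₂ (split o)))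

  count : Bool → Odd → ℕ
  count b o = tally hue b true (lettersO o)

  -- Summing `tally-split` over both colours makes the exchange of colours disappear.
  coloured-split : ∀ o → coloured (lettersO o)
                   ≡ ind (proj₁ (split o)) + coloured (lettersE (proj₂ (split o)))
  coloured-split o = begin
    coloured (lettersO o)
      ≡⟨ tally-sum hue true (lettersO o) ⟨
    count true o + count false o
      ≡⟨ cong₂ _+_ (tally-split true o) (tally-split false o) ⟩
    (ind (b ∧ true) + y) + (ind (b ∧ false) + x)
      ≡⟨ swap b ⟩
    ind b + (x + y)
      ≡⟨ cong (ind b +_) (tally-sum hue true (lettersE e)) ⟩
    ind b + coloured (lettersE e) ∎
    where
    open ≡-Reasoning
    b = proj₁ (split o)
    e = proj₂ (split o)
    x = tally hue true true (lettersE e)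
    y = tally hue false true (lettersE e)
    swap : ∀ b → (ind (b ∧ true) + y) + (ind (b ∧ false) + x) ≡ ind b + (x + y)
    swap true  = cong suc (+-comm y x)
    swap false = +-comm y x

  height-join : ∀ b e → heightO (join b e) ≡ heightE e
  height-join b e = trans (sym (height-split (join b e))) (cong (λ p → heightE (proj₂ p)) (split-join b e))

open Colouring

-- Iteration of the functional equation.

-- Prepending false turns the Even word left by split into an Odd one with the
-- same letters, so that splitting can be repeated.
convert : Colouring → Colouring → ℕ → Odd → Odd
convert S T zero    o = o
convert S T (suc F) o = join T (proj₁ (split S o)) (false ∷ convert S T F (false ∷ proj₂ (split S o)))

module _ (S T : Colouring) where

  height-convert : ∀ F o → heightO (convert S T F o) ≡ F + heightO o
  height-convert zero    o = refl
  height-convert (suc F) o = trans (height-join T _ _)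
    (cong suc (trans (height-convert F _) (cong (F +_) (height-split S o))))

  convert-pad : ∀ F o → convert S T F (pad o) ≡ pad (convert S T F o)
  convert-pad zero    o = refl
  convert-pad (suc F) o rewrite split-pad S o | convert-pad F (false ∷ proj₂ (split S o)) = join-pad T _ _

  convert-pads : ∀ F j o → convert S T F (pads j o) ≡ pads j (convert S T F o)
  convert-pads F zero    o = refl
  convert-pads F (suc j) o = trans (convert-pad F _) (cong pad (convert-pads F j o))

  split-convert : ∀ F o → split T (convert S T (suc F) o)
                  ≡ (proj₁ (split S o) , false ∷ convert S T F (false ∷ proj₂ (split S o)))
  split-convert F o = split-join T _ _

-- The `false` bits around the pads regroup with them into `suc j` empty blocks, which `join-pad`
-- pulls out one at a time.
join-pads : ∀ S j b e → join S b (false ∷ pads j (false ∷ e)) ≡ pads (suc j) (join S b e)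
join-pads S zero    b e = join-pad S b e
join-pads S (suc j) b e = trans (join-pad S b (false ∷ pads j (false ∷ e))) (cong pad (join-pads S j b e))

-- `split T` undoes the outer `join T`, and the `false` bits inserted by the two conversions meet to
-- form an empty block, which `convert-pad` carries through the remaining rounds. `join-pads` adds
-- another, so every round leaves two pads.
convert-convert : ∀ S T F o → convert T S F (convert S T F o) ≡ pads (F + F) o
convert-convert S T zero    o = refl
convert-convert S T (suc F) o
  rewrite split-convert S T F o
        | convert-pad T S F (convert S T F (false ∷ proj₂ (split S o)))
        | convert-convert S T F (false ∷ proj₂ (split S o))
        | join-pads S (suc (F + F)) (proj₁ (split S o)) (proj₂ (split S o))
        | join-split S o
        | +-suc F F = refl

module _ (S T : Colouring) where

  -- Suffices for F rounds of splitting to remove every coloured letter.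
  Settled : ℕ → Odd → Set
  Settled F o = coloured (lettersO o) ≡ 0 ⊎ weight (lettersO o) + coloured (lettersO o) ≤ F

  -- If a coloured letter is left after the split, the split has removed at least one unit of
  -- weight, while the number of coloured letters never grows. Hence the sum of the two has dropped.
  settled-split : ∀ F o → Settled (suc F) o → Settled F (false ∷ proj₂ (split S o))
  settled-split F o (inj₁ z) =
    inj₁ (m+n≡0⇒n≡0 (ind (proj₁ (split S o))) (trans (sym (coloured-split S o)) z))
  settled-split F o (inj₂ le)
    with coloured (lettersE (proj₂ (split S o))) | coloured-split S o | weight-split S o
  ... | zero  | _  | _  = inj₁ refl
  ... | suc c | p | q rewrite p | q = inj₂ (≤-pred (≤-trans (≤-trans (+-monoʳ-≤ 1 ≤-refl) (bound _ _ _)) le))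
    where
    bound : ∀ w x c → suc (w + suc c) ≤ w + suc c + (x + suc c)
    bound w x c = subst (_≤ w + suc c + (x + suc c)) (+-comm _ 1)
      (+-monoʳ-≤ (w + suc c) (≤-trans (s≤s z≤n) (m≤n+m (suc c) x)))

  -- `coloured-split` mentions no hue, so it has the same form for `S` and `T`; the `false` bits
  -- inserted by `convert` contribute no letters.
  coloured-convert : ∀ F o → coloured (lettersO (convert S T F o)) ≡ coloured (lettersO o)
  coloured-convert zero    o = refl
  coloured-convert (suc F) o = begin
    coloured (lettersO (convert S T (suc F) o))
      ≡⟨ coloured-split T (convert S T (suc F) o) ⟩
    _ ≡⟨ cong (λ p → ind (proj₁ p) + coloured (lettersE (proj₂ p))) (split-convert S T F o) ⟩
    _ ≡⟨ cong (ind (proj₁ (split S o)) +_) (coloured-convert F _) ⟩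
    _ ≡⟨ coloured-split S o ⟨
    coloured (lettersO o) ∎
    where open ≡-Reasoning

  weight-convert : ∀ F o → weight (lettersO (convert S T F o)) ≡ weight (lettersO o)
  weight-convert zero    o = refl
  weight-convert (suc F) o = begin
    weight (lettersO (convert S T (suc F) o))
      ≡⟨ weight-split T (convert S T (suc F) o) ⟩
    _ ≡⟨ cong (λ p → weight (lettersE (proj₂ p)) + coloured (lettersE (proj₂ p))) (split-convert S T F o) ⟩
    _ ≡⟨ cong₂ _+_ (weight-convert F _) (coloured-convert F _) ⟩
    _ ≡⟨ weight-split S o ⟨
    weight (lettersO o) ∎
    where open ≡-Reasoning

  -- Both words split off the same bit, and both splits exchange the colours, so the induction
  -- continues with `not b`. When the rounds are used up no coloured letter is left, and both counts
  -- vanish.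
  count-convert : ∀ F o → Settled F o → ∀ b → count T b (convert S T F o) ≡ count S b o
  count-convert zero o st b = trans (vanish T b) (sym (vanish S b))
    where
    unhued : Settled 0 o → coloured (lettersO o) ≡ 0
    unhued (inj₁ z)  = z
    unhued (inj₂ le) = m+n≡0⇒n≡0 (weight (lettersO o)) (n≤0⇒n≡0 le)
    none : coloured (lettersO o) ≡ 0
    none = unhued st
    vanish : ∀ U b → count U b o ≡ 0
    vanish U true  = m+n≡0⇒m≡0 _ (trans (tally-sum (hue U) true (lettersO o)) none)
    vanish U false = m+n≡0⇒n≡0 (count U true o) (trans (tally-sum (hue U) true (lettersO o)) none)
  count-convert (suc F) o st b = begin
    count T b (convert S T (suc F) o)
      ≡⟨ tally-split T b (convert S T (suc F) o) ⟩
    _ ≡⟨ cong (λ p → ind (proj₁ p ∧ b) + tally (hue T) (not b) true (lettersE (proj₂ p))) (split-convert S T F o) ⟩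
    _ ≡⟨ cong (ind (proj₁ (split S o) ∧ b) +_) (count-convert F _ (settled-split F o st) (not b)) ⟩
    _ ≡⟨ tally-split S b o ⟨
    count S b o ∎
    where open ≡-Reasoning

-- Colouring by the parity of the position.

-- κ is the colour bit of the nearest lower block containing a single letter (at
-- the bottom, of col 0); a single letter hands its own bit up and takes κ.
swapCell : Bool → Bool → Bool × Even → Bool × Even
swapCell true  true  (κ , e) = κ     , true  ∷ (true  ∷ e)
swapCell false false (κ , e) = κ     , false ∷ (false ∷ e)
swapCell true  false (κ , e) = true  , not κ ∷ (κ ∷ e)
swapCell false true  (κ , e) = false , not κ ∷ (κ ∷ e)

splitA : Odd → Bool × Even
splitA (c ∷ [])      = c , []
splitA (c ∷ (p ∷ o)) = swapCell c p (splitA o)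

-- Runs `splitA` backwards from the top: a block with a single letter takes the incoming bit and
-- passes its own bit down.
joinA : Bool → Even → Odd
joinA κ []                    = κ ∷ []
joinA κ (true  ∷ (true  ∷ e)) = true ∷ (true ∷ joinA κ e)
joinA κ (false ∷ (false ∷ e)) = false ∷ (false ∷ joinA κ e)
joinA κ (true  ∷ (false ∷ e)) = κ ∷ (not κ ∷ joinA false e)
joinA κ (false ∷ (true  ∷ e)) = κ ∷ (not κ ∷ joinA true e)

joinA-swapCell : ∀ c p κ e → joinA (proj₁ (swapCell c p (κ , e))) (proj₂ (swapCell c p (κ , e)))
                 ≡ c ∷ (p ∷ joinA κ e)
joinA-swapCell true  true  κ     e = refl
joinA-swapCell false false κ     e = refl
joinA-swapCell true  false true  e = refl
joinA-swapCell true  false false e = refl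
joinA-swapCell false true  true  e = refl
joinA-swapCell false true  false e = refl

joinA-splitA : ∀ o → joinA (proj₁ (splitA o)) (proj₂ (splitA o)) ≡ o
joinA-splitA (c ∷ [])      = refl
joinA-splitA (c ∷ (p ∷ o)) =
  trans (joinA-swapCell c p _ _) (cong (λ o → c ∷ (p ∷ o)) (joinA-splitA o))

splitA-joinA : ∀ b e → splitA (joinA b e) ≡ (b , e)
splitA-joinA b     []                    = refl
splitA-joinA b     (true  ∷ (true  ∷ e)) rewrite splitA-joinA b e = refl
splitA-joinA b     (false ∷ (false ∷ e)) rewrite splitA-joinA b e = refl
splitA-joinA true  (true  ∷ (false ∷ e)) rewrite splitA-joinA false e = refl
splitA-joinA false (true  ∷ (false ∷ e)) rewrite splitA-joinA false e = refl
splitA-joinA true  (false ∷ (true  ∷ e)) rewrite splitA-joinA true e = refl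
splitA-joinA false (false ∷ (true  ∷ e)) rewrite splitA-joinA true e = refl

height-splitA : ∀ o → heightE (proj₂ (splitA o)) ≡ heightO o
height-splitA (c ∷ [])      = refl
height-splitA (c ∷ (p ∷ o)) = trans (cell c p) (cong suc (height-splitA o))
  where
  cell : ∀ c p → heightE (proj₂ (swapCell c p (splitA o))) ≡ suc (heightE (proj₂ (splitA o)))
  cell true  true  = refl
  cell true  false = refl
  cell false true  = refl
  cell false false = refl

positionHue : Hue
positionHue st _ = st

-- The bit split off counts like a coloured letter in first position; the remaining letters are then
-- read from the opposite parity, whatever the bit is.
tallyA-split : ∀ b st o → tally positionHue b st (lettersO o)
               ≡ ind (proj₁ (splitA o) ∧ sameB b st) + tally positionHue b (not st) (lettersE (proj₂ (splitA o)))
tallyA-split b st (true  ∷ []) = refl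
tallyA-split b st (false ∷ []) = refl
-- A block with one letter flips the parity of the positions below it, a block with two or none
-- keeps it; hence the induction hypothesis at both states. Below, the state is a literal so that
-- `not (not st)` reduces.
tallyA-split b st (c ∷ (p ∷ o)) with splitA o | tallyA-split b st o | tallyA-split b (not st) o
tallyA-split b true (true ∷ (true ∷ o)) | κ , e | p | _ = trans (cong (ind (sameB b true) +_) p) (x∙yz≈y∙xz (ind (sameB b true)) (ind (κ ∧ sameB b true)) _)
tallyA-split b true (false ∷ (false ∷ o)) | _ , _ | p | _ = p
tallyA-split b true (true ∷ (false ∷ o)) | true , _ | _ | q = cong (ind (sameB b true) +_) q
tallyA-split b true (false ∷ (true ∷ o)) | true , _ | _ | q = q
tallyA-split b true (true ∷ (false ∷ o)) | false , _ | _ | q = cong (ind (sameB b true) +_) q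
tallyA-split b true (false ∷ (true ∷ o)) | false , _ | _ | q = q
tallyA-split b false (true ∷ (true ∷ o)) | κ , e | p | _ = trans (cong (ind (sameB b false) +_) p) (x∙yz≈y∙xz (ind (sameB b false)) (ind (κ ∧ sameB b false)) _)
tallyA-split b false (false ∷ (false ∷ o)) | _ , _ | p | _ = p
tallyA-split b false (true ∷ (false ∷ o)) | true , _ | _ | q = cong (ind (sameB b false) +_) q
tallyA-split b false (false ∷ (true ∷ o)) | true , _ | _ | q = q
tallyA-split b false (true ∷ (false ∷ o)) | false , _ | _ | q = cong (ind (sameB b false) +_) q
tallyA-split b false (false ∷ (true ∷ o)) | false , _ | _ | q = q

sameB-not : ∀ b st → sameB b (not st) ≡ sameB (not b) st
sameB-not true  st    = refl
sameB-not false true  = refl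
sameB-not false false = refl

sameB-true : ∀ b → sameB b true ≡ b
sameB-true true  = refl
sameB-true false = refl

-- Turns the flipped starting parity of `tallyA-split` into the exchange of colours demanded by
-- `tally-split`.
tally-not : ∀ b st w → tally positionHue b (not st) w ≡ tally positionHue (not b) st w
tally-not b st []          = refl
tally-not b st (pl q ∷ w)  = tally-not b (not st) w
tally-not b st (col q ∷ w) = cong₂ _+_ (cong ind (sameB-not b st)) (tally-not b (not st) w)

-- A block with both letters has weight `suc n` twice before the split and `suc n`, `n` after it;
-- the count of its coloured letter makes up the difference.
weight-both : ∀ n w c → suc n + (suc n + (w + c)) ≡ suc n + (n + w) + suc c
weight-both = solve 3 (λ n w c → con 1 :+ n :+ (con 1 :+ n :+ (w :+ c)) := con 1 :+ n :+ (n :+ w) :+ (con 1 :+ c)) refl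

-- The case of a single letter of weight `suc n` that ends up as `col n`.
weight-moved : ∀ n w c → suc n + (w + c) ≡ n + w + suc c
weight-moved = solve 3 (λ n w c → con 1 :+ n :+ (w :+ c) := n :+ w :+ (con 1 :+ c)) refl

weightA-split : ∀ o → weight (lettersO o)
                ≡ weight (lettersE (proj₂ (splitA o))) + coloured (lettersE (proj₂ (splitA o)))
weightA-split (true  ∷ []) = refl
weightA-split (false ∷ []) = refl
weightA-split (c ∷ (p ∷ o)) with splitA o | weightA-split o | height-splitA o
weightA-split (false ∷ (false ∷ o)) | _     , _ | p | _ = p
weightA-split (true  ∷ (true  ∷ o)) | _     , e | p | h rewrite h | p = weight-both (heightO o) _ _
weightA-split (true  ∷ (false ∷ o)) | true  , e | p | h rewrite h | p = weight-moved (heightO o) _ _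
weightA-split (false ∷ (true  ∷ o)) | true  , e | p | h rewrite h | p = weight-moved (heightO o) _ _
weightA-split (true  ∷ (false ∷ o)) | false , e | p | h rewrite h | p = sym (+-assoc (suc (heightO o)) _ _)
weightA-split (false ∷ (true  ∷ o)) | false , e | p | h rewrite h | p = sym (+-assoc (suc (heightO o)) _ _)

alternating : Colouring
alternating = record
  { hue          = positionHue
  ; split        = splitA
  ; join         = joinA
  ; join-split   = joinA-splitA
  ; split-join   = splitA-joinA
  ; split-pad    = λ _ → refl
  ; join-pad     = λ _ _ → refl
  ; height-split = height-splitA
  ; tally-split  = λ b o → trans (tallyA-split b true o)
      (cong₂ (λ x y → ind (proj₁ (splitA o) ∧ x) + y) (sameB-true b)
        (tally-not b true (lettersE (proj₂ (splitA o)))))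
  ; weight-split = weightA-split
  }

-- Colouring by the parity of the quotient.

-- Splits off `col 0` and turns every block over: `col (suc q)` becomes `col q`, so its quotient
-- changes parity and its colour is exchanged, while `pl q` stays.
splitC : Odd → Bool × Even
splitC (c ∷ [])      = c , []
splitC (c ∷ (p ∷ o)) = proj₁ (splitC o) , p ∷ (c ∷ proj₂ (splitC o))

joinC : Bool → Even → Odd
joinC b []            = b ∷ []
joinC b (p ∷ (c ∷ e)) = c ∷ (p ∷ joinC b e)

joinC-splitC : ∀ o → joinC (proj₁ (splitC o)) (proj₂ (splitC o)) ≡ o
joinC-splitC (c ∷ [])      = refl
joinC-splitC (c ∷ (p ∷ o)) = cong (λ o → c ∷ (p ∷ o)) (joinC-splitC o)

splitC-joinC : ∀ b e → splitC (joinC b e) ≡ (b , e)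
splitC-joinC b []            = refl
splitC-joinC b (p ∷ (c ∷ e)) = cong (λ x → proj₁ x , p ∷ (c ∷ proj₂ x)) (splitC-joinC b e)

height-splitC : ∀ o → heightE (proj₂ (splitC o)) ≡ heightO o
height-splitC (c ∷ [])      = refl
height-splitC (c ∷ (p ∷ o)) = cong suc (height-splitC o)

evenB : ℕ → Bool
evenB zero    = true
evenB (suc q) = not (evenB q)

quotientHue : Hue
quotientHue _ q = evenB q

tallyC-state : ∀ b st w → tally quotientHue b st w ≡ tally quotientHue b true w
tallyC-state b st    []          = refl
tallyC-state b st    (pl q ∷ w)  = trans (tallyC-state b (not st) w) (sym (tallyC-state b false w))
tallyC-state b st    (col q ∷ w) = cong (ind (sameB b (evenB q)) +_)
  (trans (tallyC-state b (not st) w) (sym (tallyC-state b false w)))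

tallyC-split : ∀ b o → tally quotientHue b true (lettersO o)
               ≡ ind (proj₁ (splitC o) ∧ b) + tally quotientHue (not b) true (lettersE (proj₂ (splitC o)))
tallyC-split b (true  ∷ []) rewrite sameB-true b = refl
tallyC-split b (false ∷ []) = refl
tallyC-split b (c ∷ (p ∷ o)) with splitC o | tallyC-split b o | height-splitC o
tallyC-split b (true ∷ (true ∷ o)) | κ , e | p | h
  rewrite h | p | sameB-not b (evenB (heightO o)) = x∙yz≈y∙xz (ind (sameB (not b) (evenB (heightO o)))) (ind (κ ∧ b)) _
tallyC-split b (true ∷ (false ∷ o)) | κ , e | p | h
  rewrite h | tallyC-state b false (lettersO o) | p | sameB-not b (evenB (heightO o))
        | tallyC-state (not b) false (lettersE e) = x∙yz≈y∙xz (ind (sameB (not b) (evenB (heightO o)))) (ind (κ ∧ b)) _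
tallyC-split b (false ∷ (true ∷ o)) | κ , e | p | h
  rewrite tallyC-state b false (lettersO o) | p | tallyC-state (not b) false (lettersE e) = refl
tallyC-split b (false ∷ (false ∷ o)) | κ , e | p | h = p

weightC-split : ∀ o → weight (lettersO o)
                ≡ weight (lettersE (proj₂ (splitC o))) + coloured (lettersE (proj₂ (splitC o)))
weightC-split (true  ∷ []) = refl
weightC-split (false ∷ []) = refl
weightC-split (c ∷ (p ∷ o)) with splitC o | weightC-split o | height-splitC o
weightC-split (true  ∷ (true  ∷ o)) | _ , e | p | h rewrite h | p = weight-both (heightO o) _ _
weightC-split (true  ∷ (false ∷ o)) | _ , e | p | h rewrite h | p = weight-moved (heightO o) _ _
weightC-split (false ∷ (true  ∷ o)) | _ , e | p | h rewrite h | p = sym (+-assoc (suc (heightO o)) _ _)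
weightC-split (false ∷ (false ∷ o)) | _ , e | p | h = p

byQuotient : Colouring
byQuotient = record
  { hue          = quotientHue
  ; split        = splitC
  ; join         = joinC
  ; join-split   = joinC-splitC
  ; split-join   = splitC-joinC
  ; split-pad    = λ _ → refl
  ; join-pad     = λ _ _ → refl
  ; height-split = height-splitC
  ; tally-split  = tallyC-split
  ; weight-split = weightC-split
  }

-- Sorted lists of letters and their words.

mutual
  -- Strictly decreasing lists whose first letter is smaller than `col n` (for `BelowE n`) or `pl n`
  -- (for `BelowO n`): the letters available to a word of height `n`.
  BelowE : ℕ → List Letter → Set
  BelowE n []          = ⊤
  BelowE n (col q ∷ w) = q < n × BelowE q w
  BelowE n (pl q ∷ w)  = q < n × BelowO q w

  BelowO : ℕ → List Letter → Set
  BelowO n []          = ⊤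
  BelowO n (col q ∷ w) = q ≤ n × BelowE q w
  BelowO n (pl q ∷ w)  = q < n × BelowO q w

BelowE⇒BelowO : ∀ {n} w → BelowE n w → BelowO n w
BelowE⇒BelowO []          b        = tt
BelowE⇒BelowO (col q ∷ w) (lt , b) = <⇒≤ lt , b
BelowE⇒BelowO (pl q ∷ w)  (lt , b) = lt , b

BelowO⇒BelowE : ∀ {n} w → BelowO n w → BelowE (suc n) w
BelowO⇒BelowE []          b        = tt
BelowO⇒BelowE (col q ∷ w) (le , b) = s≤s le , b
BelowO⇒BelowE (pl q ∷ w)  (lt , b) = m<n⇒m<1+n lt , b

Sorted : List Letter → Set
Sorted []          = ⊤
Sorted (col q ∷ w) = BelowE q w
Sorted (pl q ∷ w)  = BelowO q w

BelowO⇒Sorted : ∀ {n} w → BelowO n w → Sorted w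
BelowO⇒Sorted []          b       = tt
BelowO⇒Sorted (col q ∷ w) (_ , b) = b
BelowO⇒Sorted (pl q ∷ w)  (_ , b) = b

-- No letter weighs more than the whole list, so height `n` has room for it.
BelowO-weight : ∀ {n} w → weight w ≤ n → Sorted w → BelowO n w
BelowO-weight []          le b = tt
BelowO-weight (col q ∷ w) le b = m+n≤o⇒m≤o q le , b
BelowO-weight (pl q ∷ w)  le b = m+n≤o⇒m≤o (suc q) le , b

mutual
  lettersE-below : ∀ e → BelowE (heightE e) (lettersE e)
  lettersE-below []          = tt
  lettersE-below (true ∷ o)  = ≤-refl , lettersO-below o
  lettersE-below (false ∷ o) = BelowO⇒BelowE (lettersO o) (lettersO-below o)

  lettersO-below : ∀ o → BelowO (heightO o) (lettersO o)
  lettersO-below (true ∷ e)  = ≤-refl , lettersE-below e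
  lettersO-below (false ∷ e) = BelowE⇒BelowO (lettersE e) (lettersE-below e)

mutual
  wordE : ℕ → List Letter → Even
  wordE zero    w           = []
  wordE (suc n) []          = false ∷ wordO n []
  wordE (suc n) (col q ∷ w) = false ∷ wordO n (col q ∷ w)
  wordE (suc n) (pl q ∷ w)  with q ≟ n
  ... | yes _ = true ∷ wordO n w
  ... | no  _ = false ∷ wordO n (pl q ∷ w)

  wordO : ℕ → List Letter → Odd
  wordO n []          = false ∷ wordE n []
  wordO n (pl q ∷ w)  = false ∷ wordE n (pl q ∷ w)
  wordO n (col q ∷ w) with q ≟ n
  ... | yes _ = true ∷ wordE n w
  ... | no  _ = false ∷ wordE n (col q ∷ w)

mutual
  heightE-word : ∀ n w → heightE (wordE n w) ≡ n
  heightE-word zero    w           = refl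
  heightE-word (suc n) []          = cong suc (heightO-word n [])
  heightE-word (suc n) (col q ∷ w) = cong suc (heightO-word n (col q ∷ w))
  heightE-word (suc n) (pl q ∷ w)  with q ≟ n
  ... | yes _ = cong suc (heightO-word n w)
  ... | no  _ = cong suc (heightO-word n (pl q ∷ w))

  heightO-word : ∀ n w → heightO (wordO n w) ≡ n
  heightO-word n []          = heightE-word n []
  heightO-word n (pl q ∷ w)  = heightE-word n (pl q ∷ w)
  heightO-word n (col q ∷ w) with q ≟ n
  ... | yes _ = heightE-word n w
  ... | no  _ = heightE-word n (col q ∷ w)

mutual
  lettersE-word : ∀ n w → BelowE n w → lettersE (wordE n w) ≡ w
  lettersE-word zero    []          b        = refl
  lettersE-word zero    (col q ∷ w) (() , _)
  lettersE-word zero    (pl q ∷ w)  (() , _)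
  lettersE-word (suc n) []          b        = lettersO-word n [] tt
  lettersE-word (suc n) (col q ∷ w) (lt , b) = lettersO-word n (col q ∷ w) (≤-pred lt , b)
  lettersE-word (suc n) (pl q ∷ w)  (lt , b) with q ≟ n
  ... | yes refl = cong₂ (λ h v → pl h ∷ v) (heightO-word n w) (lettersO-word n w b)
  ... | no q≢n   = lettersO-word n (pl q ∷ w) (≤∧≢⇒< (≤-pred lt) q≢n , b)

  lettersO-word : ∀ n w → BelowO n w → lettersO (wordO n w) ≡ w
  lettersO-word n []          b        = lettersE-word n [] tt
  lettersO-word n (pl q ∷ w)  (lt , b) = lettersE-word n (pl q ∷ w) (lt , b)
  lettersO-word n (col q ∷ w) (le , b) with q ≟ n
  ... | yes refl = cong₂ (λ h v → col h ∷ v) (heightE-word n w) (lettersE-word n w b)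
  ... | no q≢n   = lettersE-word n (col q ∷ w) (≤∧≢⇒< le q≢n , b)

wordO-below : ∀ n w → BelowE n w → wordO n w ≡ false ∷ wordE n w
wordO-below n []          b        = refl
wordO-below n (pl q ∷ w)  b        = refl
wordO-below n (col q ∷ w) (lt , _) with q ≟ n
... | yes refl = contradiction lt (<-irrefl refl)
... | no _     = refl

wordE-below : ∀ n w → BelowO n w → wordE (suc n) w ≡ false ∷ wordO n w
wordE-below n []          b        = refl
wordE-below n (col q ∷ w) b        = refl
wordE-below n (pl q ∷ w)  (lt , _) with q ≟ n
... | yes refl = contradiction lt (<-irrefl refl)
... | no _     = refl

mutual
  wordE-letters : ∀ e → wordE (heightE e) (lettersE e) ≡ e
  wordE-letters []          = refl
  wordE-letters (true ∷ o)  with heightO o ≟ heightO o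
  ... | yes _ = cong (true ∷_) (wordO-letters o)
  ... | no ¬p = contradiction refl ¬p
  wordE-letters (false ∷ o) =
    trans (wordE-below _ (lettersO o) (lettersO-below o)) (cong (false ∷_) (wordO-letters o))

  wordO-letters : ∀ o → wordO (heightO o) (lettersO o) ≡ o
  wordO-letters (true ∷ e)  with heightE e ≟ heightE e
  ... | yes _ = cong (true ∷_) (wordE-letters e)
  ... | no ¬p = contradiction refl ¬p
  wordO-letters (false ∷ e) =
    trans (wordO-below _ (lettersE e) (lettersE-below e)) (cong (false ∷_) (wordE-letters e))

height-pads : ∀ j o → heightO (pads j o) ≡ j + heightO o
height-pads zero    o = refl
height-pads (suc j) o = cong suc (height-pads j o)

letters-injective : ∀ {u v} → heightO u ≡ heightO v → lettersO u ≡ lettersO v → u ≡ v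
letters-injective {u} {v} h l =
  trans (sym (wordO-letters u)) (trans (cong₂ wordO h l) (wordO-letters v))

-- Conversion of sorted lists of letters.

-- `n` is both the height of the word and the number of rounds; the size of the partition will be
-- large enough for both.
convertLetters : Colouring → Colouring → ℕ → List Letter → List Letter
convertLetters S T n w = lettersO (convert S T n (wordO n w))

module _ (S T : Colouring) (n : ℕ) (w : List Letter) (below : BelowO n w) where

  private
    v = wordO n w

  convertLetters-weight : weight (convertLetters S T n w) ≡ weight w
  convertLetters-weight =
    trans (weight-convert S T n v) (cong weight (lettersO-word n w below))

  convertLetters-sorted : Sorted (convertLetters S T n w)
  convertLetters-sorted = BelowO⇒Sorted _ (lettersO-below (convert S T n v))

  convertLetters-tally : weight w + coloured w ≤ n → ∀ b →
    tally (hue T) b true (convertLetters S T n w) ≡ tally (hue S) b true w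
  convertLetters-tally le b = trans
    (count-convert S T n v (inj₂ (subst (λ l → weight l + coloured l ≤ n) (sym (lettersO-word n w below)) le)) b)
    (cong (tally (hue S) b true) (lettersO-word n w below))

  convertLetters-inverse : weight w ≤ n → convertLetters T S n (convertLetters S T n w) ≡ w
  convertLetters-inverse le = begin
    lettersO (convert T S n v′)
      ≡⟨ letters-pads n _ ⟨
    lettersO (pads n (convert T S n v′))
      ≡⟨ cong lettersO (convert-pads T S n n v′) ⟨
    lettersO (convert T S n (pads n v′))
      ≡⟨ cong (λ x → lettersO (convert T S n x)) extends ⟩
    lettersO (convert T S n u)
      ≡⟨ cong lettersO (convert-convert S T n v) ⟩
    lettersO (pads (n + n) v)
      ≡⟨ letters-pads (n + n) v ⟩
    lettersO v
      ≡⟨ lettersO-word n w below ⟩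
    w ∎
    where
    open ≡-Reasoning
    u = convert S T n v
    v′ = wordO n (lettersO u)
    -- `u` has height `n + n` but the re-encoded `v′` only `n`; as the weight is at most `n` no
    -- letter is lost, and `n` empty blocks make up the difference.
    extends : pads n v′ ≡ u
    extends = letters-injective
      (trans (height-pads n v′) (trans (cong (n +_) (trans (heightO-word n (lettersO u)) (sym (heightO-word n w))))
        (sym (height-convert S T n v))))
      (trans (letters-pads n v′) (lettersO-word n _
        (BelowO-weight (lettersO u) (subst (_≤ n) (sym convertLetters-weight) le) convertLetters-sorted)))

-- The order of the letters.

_≺_ : Letter → Letter → Set
col q′ ≺ col q = q′ < q
pl q′  ≺ col q = q′ < q
col q′ ≺ pl q  = q′ ≤ q
pl q′  ≺ pl q  = q′ < q

≺-trans : ∀ x y z → x ≺ y → y ≺ z → x ≺ z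
≺-trans (col a) (col b) (col c) p q = <-trans p q
≺-trans (col a) (col b) (pl c)  p q = ≤-trans (<⇒≤ p) q
≺-trans (col a) (pl b)  (col c) p q = ≤-<-trans p q
≺-trans (col a) (pl b)  (pl c)  p q = ≤-trans p (<⇒≤ q)
≺-trans (pl a)  (col b) (col c) p q = <-trans p q
≺-trans (pl a)  (col b) (pl c)  p q = <-≤-trans p q
≺-trans (pl a)  (pl b)  (col c) p q = <-trans p q
≺-trans (pl a)  (pl b)  (pl c)  p q = <-trans p q

Sorted-cons : ∀ x y w → y ≺ x → Sorted (y ∷ w) → Sorted (x ∷ y ∷ w)
Sorted-cons (col _) (col _) w p s = p , s
Sorted-cons (col _) (pl _)  w p s = p , s
Sorted-cons (pl _)  (col _) w p s = p , s
Sorted-cons (pl _)  (pl _)  w p s = p , s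

Sorted-uncons : ∀ x y w → Sorted (x ∷ y ∷ w) → y ≺ x × Sorted (y ∷ w)
Sorted-uncons (col _) (col _) w s = s
Sorted-uncons (col _) (pl _)  w s = s
Sorted-uncons (pl _)  (col _) w s = s
Sorted-uncons (pl _)  (pl _)  w s = s

Sorted-singleton : ∀ x → Sorted (x ∷ [])
Sorted-singleton (col _) = tt
Sorted-singleton (pl _)  = tt

-- `Sorted` compares neighbours, whereas `kStrict` compares a part with all later ones; this bridges
-- the gap.
Sorted-skip : ∀ x y w → Sorted (x ∷ y ∷ w) → Sorted (x ∷ w)
Sorted-skip x y []      s = Sorted-singleton x
Sorted-skip x y (z ∷ w) s with Sorted-uncons x y (z ∷ w) s
... | y≺x , s′ with Sorted-uncons y z w s′
... | z≺y , s″ = Sorted-cons x z w (≺-trans z y x z≺y y≺x) s″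

-- Parts of partitions as letters with a residue.

countB-cons : ∀ p a l → countB p (a ∷ l) ≡ ind (p a) + countB p l
countB-cons p a l with p a
... | true  = refl
... | false = refl

0<head : ∀ a l → T (strictDecr (a ∷ l)) → 0 < a
0<head a []      t = <ᵇ⇒< 0 a t
0<head a (b ∷ l) t = ≤-<-trans z≤n (<ᵇ⇒< b a (proj₁ (to T-∧ t)))

strictDecr-tail : ∀ a l → T (strictDecr (a ∷ l)) → T (strictDecr l)
strictDecr-tail a []      t = tt
strictDecr-tail a (b ∷ l) t = proj₂ (to T-∧ t)

residue : ℕ → Bool → ℕ
residue m true  = 3 ∸ m
residue m false = m

quotient : Letter → ℕ
quotient (col q) = q
quotient (pl q)  = suc q

halve : ∀ q → Σ ℕ λ h → q ≡ ind (not (evenB q)) + h * 2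
halve zero    = 0 , refl
halve (suc q) with evenB q | halve q
... | true  | h , eq = h , cong suc eq
... | false | h , eq = suc h , cong suc eq

module Parts (k₀ m : ℕ)
  (r>0 : ∀ b → 0 < residue m b) (r<k : ∀ b → residue m b < suc k₀)
  (r≢r : residue m true ≢ residue m false) where

  private
    k : ℕ
    k = suc k₀

    r : Bool → ℕ
    r = residue m

  part : Bool → Letter → ℕ
  part b (col q) = r b + q * k
  part b (pl q)  = suc q * k

  -- Forgets the residue of a coloured part, which the hue restores. The `pred` is there because
  -- `pl q` stands for `suc q * k`.
  decode : ℕ → Letter
  decode a = if congB k 0 a then pl (pred (a div k)) else col (a div k)

  encode : Hue → Bool → List Letter → List ℕ
  encode χ st []      = []
  encode χ st (l ∷ w) = part (χ st (quotient l)) l ∷ encode χ (not st) w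

  part-div : ∀ b l → part b l div k ≡ quotient l
  part-div b (pl q)  = m*n/n≡m (suc q) k
  part-div b (col q) = begin
    (r b + q * k) / k       ≡⟨ +-distrib-/-∣ʳ (r b) (divides q refl) ⟩
    r b / k + q * k / k     ≡⟨ cong₂ _+_ (m<n⇒m/n≡0 (r<k b)) (m*n/n≡m q k) ⟩
    q                       ∎
    where open ≡-Reasoning

  part-mod-col : ∀ b q → part b (col q) mod k ≡ r b
  part-mod-col b q = trans ([m+kn]%n≡m%n (r b) q k) (m<n⇒m%n≡m (r<k b))

  part-mod-pl : ∀ b q → part b (pl q) mod k ≡ 0
  part-mod-pl b q = m*n%n≡0 (suc q) k

  r≢0 : ∀ b → r b ≢ 0
  r≢0 b = >⇒≢ (r>0 b)

  decode-part : ∀ b l → decode (part b l) ≡ l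
  decode-part b (pl q)  rewrite part-mod-pl b q | part-div b (pl q) = refl
  decode-part b (col q)
    rewrite part-mod-col b q | part-div b (col q) | dec-false (r b ≟ 0) (r≢0 b) = refl

  decode-encode : ∀ χ st w → map decode (encode χ st w) ≡ w
  decode-encode χ st []      = refl
  decode-encode χ st (l ∷ w) = cong₂ _∷_ (decode-part _ l) (decode-encode χ (not st) w)

  -- The sum depends only on the weight and the two tallies, the quantities that the conversion
  -- preserves.
  sum-encode : ∀ χ st w → sum (encode χ st w)
               ≡ weight w * k + (r true * tally χ true st w + r false * tally χ false st w)
  sum-encode χ st [] rewrite *-zeroʳ (r true) | *-zeroʳ (r false) = refl
  sum-encode χ st (pl q ∷ w) rewrite sum-encode χ (not st) w =
    trans (sym (+-assoc (suc q * k) (weight w * k) _))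
      (cong (_+ (r true * tally χ true (not st) w + r false * tally χ false (not st) w))
        (sym (*-distribʳ-+ k (suc q) (weight w))))
  sum-encode χ st (col q ∷ w) rewrite sum-encode χ (not st) w with χ st q
  ... | true  = solve 7 (λ a b q k w x y →
                  a :+ q :* k :+ (w :* k :+ (a :* x :+ b :* y))
                  := (q :+ w) :* k :+ (a :* (con 1 :+ x) :+ b :* y)) refl
                  (r true) (r false) q k (weight w) (tally χ true (not st) w) (tally χ false (not st) w)
  ... | false = solve 7 (λ a b q k w x y →
                  b :+ q :* k :+ (w :* k :+ (a :* x :+ b :* y))
                  := (q :+ w) :* k :+ (a :* x :+ b :* (con 1 :+ y))) refl
                  (r true) (r false) q k (weight w) (tally χ true (not st) w) (tally χ false (not st) w)

  -- As `k` and both residues are positive, the size of a partition suffices as the number of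
  -- rounds.
  weight+coloured≤sum : ∀ χ st w → weight w + coloured w ≤ sum (encode χ st w)
  weight+coloured≤sum χ st w = begin
    weight w + coloured w
      ≡⟨ cong (weight w +_) (tally-sum χ st w) ⟨
    weight w + (x + y)
      ≤⟨ +-mono-≤ (m≤m*n (weight w) k) (+-mono-≤ (m≤n*m x (r true)) (m≤n*m y (r false))) ⟩
    weight w * k + (r true * x + r false * y)
      ≡⟨ sum-encode χ st w ⟨
    sum (encode χ st w) ∎
    where
    open ≤-Reasoning
    x = tally χ true st w
    y = tally χ false st w
    instance
      _ = >-nonZero (r>0 true)
      _ = >-nonZero (r>0 false)

  mod-div : ∀ a → a ≡ a mod k + (a div k) * k
  mod-div a = m≡m%n+[m/n]*n a k

  fits : Bool → ℕ → Bool
  fits b a = congB k 0 a ∨ congB k (r b) a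

  multiple : ∀ a → 0 < a → ((a mod k) ≡ᵇ 0) ≡ true → Σ ℕ λ q → a div k ≡ suc q × a ≡ suc q * k
  multiple a a>0 e with a div k | mod-div a
  ... | zero  | p = contradiction (trans p (trans (+-identityʳ _) (≡ᵇ⇒≡ (a mod k) 0 (from T-≡ e)))) (>⇒≢ a>0)
  ... | suc q | p = q , refl , trans p (cong (_+ suc q * k) (≡ᵇ⇒≡ (a mod k) 0 (from T-≡ e)))

  part-decode : ∀ b a → 0 < a → T (fits b a) → part b (decode a) ≡ a
  part-decode b a a>0 t with (a mod k) ≡ᵇ 0 in e
  ... | false = sym (trans (mod-div a) (cong (_+ (a div k) * k) (≡ᵇ⇒≡ (a mod k) (r b) t)))
  ... | true with multiple a a>0 e
  ...   | q , d , p rewrite d = sym p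

  quotient-decode : ∀ a → 0 < a → quotient (decode a) ≡ a div k
  quotient-decode a a>0 with (a mod k) ≡ᵇ 0 in e
  ... | false = refl
  ... | true with multiple a a>0 e
  ...   | q , d , _ rewrite d = refl

  -- The congruence conditions of both kinds in a common form.
  Fits : Hue → Bool → List ℕ → Set
  Fits χ st []      = ⊤
  Fits χ st (a ∷ l) = T (fits (χ st (a div k)) a) × Fits χ (not st) l

  fits-part : ∀ b l → T (fits b (part b l))
  fits-part b (pl q)  rewrite part-mod-pl b q = tt
  fits-part b (col q) rewrite part-mod-col b q = from T-∨ (inj₂ (≡⇒≡ᵇ (r b) (r b) refl))

  Fits-encode : ∀ χ st w → Fits χ st (encode χ st w)
  Fits-encode χ st []      = tt
  Fits-encode χ st (l ∷ w) rewrite part-div (χ st (quotient l)) l =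
    fits-part _ l , Fits-encode χ (not st) w

  encode-decode : ∀ χ st π → T (strictDecr π) → Fits χ st π → encode χ st (map decode π) ≡ π
  encode-decode χ st []      d f       = refl
  encode-decode χ st (a ∷ l) d (t , f) = cong₂ _∷_
    (trans (cong (λ q → part (χ st q) (decode a)) (quotient-decode a a>0)) (part-decode _ a a>0 t))
    (encode-decode χ (not st) l (strictDecr-tail a l d) f)
    where a>0 = 0<head a l d

  -- Strictness of partitions and sortedness of letters.

  noClash : ℕ → ℕ → Bool
  noClash a b = not (clash k a b)

  noClash-intro : ∀ a b →
    (T (not ((a mod k) ≡ᵇ 0)) → T (not ((b mod k) ≡ᵇ 0)) → a div k ≢ b div k) → T (noClash a b)
  noClash-intro a b f with a ≡ᵇ b
  ... | true = tt
  ... | false with (a mod k) ≡ᵇ 0 | (b mod k) ≡ᵇ 0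
  ...   | true  | _     = tt
  ...   | false | true  = tt
  ...   | false | false rewrite dec-false (a div k ≟ b div k) (f tt tt) = tt

  -- Quotients are weakly monotone. Strictness comes from `noClash` for two coloured parts; when `a`
  -- is a multiple of `k`, it comes from comparing with `a` itself.
  decode-≺ : ∀ a b → 0 < b → b < a → T (noClash a b) → decode b ≺ decode a
  decode-≺ a b b>0 b<a nc with (a mod k) ≡ᵇ 0 in ea | (b mod k) ≡ᵇ 0 in eb
  ... | false | false = ≤∧≢⇒< (/-monoˡ-≤ k (<⇒≤ b<a)) distinct
    where
    distinct : b div k ≢ a div k
    distinct e rewrite dec-false (a ≟ b) (>⇒≢ b<a) | dec-true (a div k ≟ b div k) (sym e) = nc
  ... | false | true with multiple b b>0 eb
  ...   | q , e , _ rewrite e = subst (_≤ a div k) e (/-monoˡ-≤ k (<⇒≤ b<a))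
  decode-≺ a b b>0 b<a nc | true | false with multiple a (<-trans b>0 b<a) ea
  ...   | q , e , p rewrite e = ≤-pred (*-cancelʳ-< k (b div k) (suc q) (begin-strict
    (b div k) * k  ≤⟨ m≤n+m _ (b mod k) ⟩
    b mod k + (b div k) * k  ≡⟨ mod-div b ⟨
    b              <⟨ b<a ⟩
    a              ≡⟨ p ⟩
    suc q * k      ∎))
    where open ≤-Reasoning
  decode-≺ a b b>0 b<a nc | true | true with multiple a (<-trans b>0 b<a) ea | multiple b b>0 eb
  ...   | q , e , p | q′ , e′ , p′ rewrite e | e′ =
    ≤-pred (*-cancelʳ-< k (suc q′) (suc q) (subst₂ _<_ p′ p b<a))

  Separated : List ℕ → Set
  Separated []          = ⊤
  Separated (a ∷ [])    = ⊤
  Separated (a ∷ b ∷ l) = T (noClash a b) × Separated (b ∷ l)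

  decode-sorted : ∀ π → T (strictDecr π) → Separated π → Sorted (map decode π)
  decode-sorted []          d s        = tt
  decode-sorted (a ∷ [])    d s        = Sorted-singleton (decode a)
  decode-sorted (a ∷ b ∷ l) d (nc , s) = Sorted-cons (decode a) (decode b) (map decode l)
    (decode-≺ a b (0<head b l (proj₂ d′)) (<ᵇ⇒< b a (proj₁ d′)) nc)
    (decode-sorted (b ∷ l) (proj₂ d′) s)
    where
    d′ : T (b <ᵇ a) × T (strictDecr (b ∷ l))
    d′ = to T-∧ d

  -- With either residue, `col q` lies strictly between `q * k` and `suc q * k`, so the letters
  -- alone decide the order.
  part-mono : ∀ b c x y → y ≺ x → part c y < part b x
  part-mono b c (col q) (col q′) p = begin-strict
    r c + q′ * k  <⟨ +-monoˡ-< (q′ * k) (r<k c) ⟩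
    suc q′ * k    ≤⟨ *-monoˡ-≤ k p ⟩
    q * k         ≤⟨ m≤n+m (q * k) (r b) ⟩
    r b + q * k   ∎
    where open ≤-Reasoning
  part-mono b c (col q) (pl q′) p = begin-strict
    suc q′ * k    ≤⟨ *-monoˡ-≤ k p ⟩
    q * k         <⟨ +-monoˡ-< (q * k) (r>0 b) ⟩
    r b + q * k   ∎
    where open ≤-Reasoning
  part-mono b c (pl q) (col q′) p = begin-strict
    r c + q′ * k  <⟨ +-monoˡ-< (q′ * k) (r<k c) ⟩
    suc q′ * k    ≤⟨ *-monoˡ-≤ k (s≤s p) ⟩
    suc q * k     ∎
    where open ≤-Reasoning
  part-mono b c (pl q) (pl q′) p = *-monoˡ-< k (s≤s p)

  part>0 : ∀ b l → 0 < part b l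
  part>0 b (col q) = ≤-trans (r>0 b) (m≤m+n (r b) (q * k))
  part>0 b (pl q)  = s≤s z≤n

  encode-strictDecr : ∀ χ st w → Sorted w → T (strictDecr (encode χ st w))
  encode-strictDecr χ st []          s = tt
  encode-strictDecr χ st (x ∷ [])    s = <⇒<ᵇ (part>0 _ x)
  encode-strictDecr χ st (x ∷ y ∷ w) s = from T-∧
    ( <⇒<ᵇ (part-mono _ _ x y (proj₁ (Sorted-uncons x y w s)))
    , encode-strictDecr χ (not st) (y ∷ w) (proj₂ (Sorted-uncons x y w s)))

  -- Each quotient has only one coloured letter, so distinct coloured letters have distinct
  -- quotients.
  part-noClash : ∀ b c x y → y ≺ x → T (noClash (part b x) (part c y))
  part-noClash b c x y p = noClash-intro (part b x) (part c y) (apart x y p)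
    where
    apart : ∀ x y → y ≺ x → T (not ((part b x mod k) ≡ᵇ 0)) → T (not ((part c y mod k) ≡ᵇ 0)) →
            part b x div k ≢ part c y div k
    apart (pl q)  y        p s t rewrite part-mod-pl b q = contradiction s (λ ())
    apart (col q) (pl q′)  p s t rewrite part-mod-pl c q′ = contradiction t (λ ())
    apart (col q) (col q′) p s t rewrite part-div b (col q) | part-div c (col q′) = >⇒≢ p

  encode-allB : ∀ χ st b x w → Sorted (x ∷ w) → T (allB (noClash (part b x)) (encode χ st w))
  encode-allB χ st b x []      s = tt
  encode-allB χ st b x (y ∷ w) s = from T-∧
    (part-noClash b _ x y (proj₁ (Sorted-uncons x y w s)) , encode-allB χ (not st) b x w (Sorted-skip x y w s))

  Sorted-tail : ∀ x w → Sorted (x ∷ w) → Sorted w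
  Sorted-tail x []      s = tt
  Sorted-tail x (y ∷ w) s = proj₂ (Sorted-uncons x y w s)

  encode-kStrict : ∀ χ st w → Sorted w → T (kStrict k (encode χ st w))
  encode-kStrict χ st []      s = tt
  encode-kStrict χ st (x ∷ w) s = from T-∧ (encode-allB χ (not st) _ x w s , encode-kStrict χ (not st) w (Sorted-tail x w s))

  kStrict-separated : ∀ π → T (kStrict k π) → Separated π
  kStrict-separated []          t = tt
  kStrict-separated (a ∷ [])    t = tt
  kStrict-separated (a ∷ b ∷ l) t =
    proj₁ (to (T-∧ {noClash a b}) (proj₁ t′)) , kStrict-separated (b ∷ l) (proj₂ t′)
    where
    t′ : T (allB (noClash a) (b ∷ l)) × T (kStrict k (b ∷ l))
    t′ = to T-∧ t

  -- For the second kind the quotient determines the residue, so two coloured parts with the same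
  -- quotient would be equal, against strict decrease.
  Fits-separated : ∀ st π → T (strictDecr π) → Fits quotientHue st π → Separated π
  Fits-separated st []          d f              = tt
  Fits-separated st (a ∷ [])    d f              = tt
  Fits-separated st (a ∷ b ∷ l) d (t , f@(u , _)) =
    noClash-intro a b (λ x y z → contradiction
      (trans (exact a t x) (trans (cong (λ q → r (evenB q) + q * k) z) (sym (exact b u y))))
      (>⇒≢ (<ᵇ⇒< b a (proj₁ d′))))
    , Fits-separated (not st) (b ∷ l) (proj₂ d′) f
    where
    d′ : T (b <ᵇ a) × T (strictDecr (b ∷ l))
    d′ = to T-∧ d
    exact : ∀ a → T (fits (evenB (a div k)) a) → T (not ((a mod k) ≡ᵇ 0)) → a ≡ r (evenB (a div k)) + (a div k) * k
    exact a t x with (a mod k) ≡ᵇ 0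
    ... | false = trans (mod-div a) (cong (_+ (a div k) * k) (≡ᵇ⇒≡ (a mod k) _ t))

  -- Residues modulo `2 * k`.

  lift : Bool → ℕ → ℕ
  lift true  x = x
  lift false x = k + x

  -- With the quotient written as `o + h * 2`, where `o` is 0 or 1, the multiple `h * (2 * k)` drops
  -- out and `o * k + a mod k` is already below `2 * k`.
  mod-double : ∀ a → a mod (2 * k) ≡ lift (evenB (a div k)) (a mod k)
  mod-double a with halve (a div k)
  ... | h , eq = begin
    a % (2 * k)                                ≡⟨ cong (_% (2 * k)) regroup ⟩
    (o * k + a mod k + h * (2 * k)) % (2 * k)  ≡⟨ [m+kn]%n≡m%n (o * k + a mod k) h (2 * k) ⟩
    (o * k + a mod k) % (2 * k)                ≡⟨ m<n⇒m%n≡m (small even) ⟩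
    o * k + a mod k                            ≡⟨ lifted even ⟩
    lift even (a mod k)                        ∎
    where
    open ≡-Reasoning
    even = evenB (a div k)
    o = ind (not even)
    small : ∀ b → ind (not b) * k + a mod k < 2 * k
    small true  = <-≤-trans (m%n<n a k) (m≤m+n k (k + 0))
    small false rewrite +-identityʳ k₀ = +-monoʳ-< k (m%n<n a k)
    lifted : ∀ b → ind (not b) * k + a mod k ≡ lift b (a mod k)
    lifted true  = refl
    lifted false = cong (_+ a mod k) (+-identityʳ k)
    regroup : a ≡ o * k + a mod k + h * (2 * k)
    regroup = trans (mod-div a) (trans (cong (λ q → a mod k + q * k) eq)
      (solve 4 (λ x o h k → x :+ (o :+ h :* con 2) :* k := o :* k :+ x :+ h :* (con 2 :* k)) refl
        (a mod k) o h k))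

  classC : Bool → ℕ → Bool
  classC b = congB (2 * k) (if b then 3 ∸ m else k + m)

  condC : ℕ → Bool
  condC a = congB (2 * k) (3 ∸ m) a ∨ congB (2 * k) k a
            ∨ congB (2 * k) (k + m) a ∨ congB (2 * k) 0 a

  -- Modulo `2 * k`, the classes `3 - m` and 0 belong to even quotients by `k`, the classes `k` and
  -- `k + m` to odd ones; the size of the residue rules out the wrong pair.
  condC⇒fits : ∀ a → T (condC a) → T (fits (evenB (a div k)) a)
  condC⇒fits a t rewrite mod-double a = go (evenB (a div k)) (a mod k) (m%n<n a k) t
    where
    go : ∀ b x → x < k →
         T ((lift b x ≡ᵇ r true) ∨ (lift b x ≡ᵇ k) ∨ (lift b x ≡ᵇ k + r false) ∨ (lift b x ≡ᵇ 0)) →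
         T ((x ≡ᵇ 0) ∨ (x ≡ᵇ r b))
    go true x x<k t with to (T-∨ {x ≡ᵇ r true}) t
    ... | inj₁ u = from (T-∨ {x ≡ᵇ 0}) (inj₂ u)
    ... | inj₂ t with to (T-∨ {x ≡ᵇ k}) t
    ...   | inj₁ u = contradiction (≡ᵇ⇒≡ x k u) (<⇒≢ x<k)
    ...   | inj₂ t with to (T-∨ {x ≡ᵇ k + r false}) t
    ...     | inj₁ u = contradiction (≡ᵇ⇒≡ x _ u) (<⇒≢ (<-≤-trans x<k (m≤m+n k _)))
    ...     | inj₂ u = from T-∨ (inj₁ u)
    go false x x<k t with to (T-∨ {k + x ≡ᵇ r true}) t
    ... | inj₁ u = contradiction (sym (≡ᵇ⇒≡ (k + x) _ u)) (<⇒≢ (<-≤-trans (r<k true) (m≤m+n k x)))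
    ... | inj₂ t with to (T-∨ {k + x ≡ᵇ k}) t
    ...   | inj₁ u = from T-∨ (inj₁ (≡⇒≡ᵇ x 0 (+-cancelˡ-≡ k x 0 (trans (≡ᵇ⇒≡ (k + x) k u) (sym (+-identityʳ k))))))
    ...   | inj₂ t with to (T-∨ {k + x ≡ᵇ k + r false}) t
    ...     | inj₁ u = from (T-∨ {x ≡ᵇ 0}) (inj₂ (≡⇒≡ᵇ x (r false) (+-cancelˡ-≡ k x (r false) (≡ᵇ⇒≡ (k + x) _ u))))

  fits⇒condC : ∀ a → T (fits (evenB (a div k)) a) → T (condC a)
  fits⇒condC a t rewrite mod-double a = go (evenB (a div k)) (a mod k) t
    where
    go : ∀ b x → T ((x ≡ᵇ 0) ∨ (x ≡ᵇ r b)) →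
         T ((lift b x ≡ᵇ r true) ∨ (lift b x ≡ᵇ k) ∨ (lift b x ≡ᵇ k + r false) ∨ (lift b x ≡ᵇ 0))
    go b x t with to (T-∨ {x ≡ᵇ 0}) t
    go true  x t | inj₁ u = from (T-∨ {x ≡ᵇ r true}) (inj₂ (from (T-∨ {x ≡ᵇ k}) (inj₂ (from (T-∨ {x ≡ᵇ k + r false}) (inj₂ u)))))
    go true  x t | inj₂ u = from T-∨ (inj₁ u)
    go false x t | inj₁ u = from (T-∨ {k + x ≡ᵇ r true}) (inj₂ (from T-∨ (inj₁
      (≡⇒≡ᵇ (k + x) k (trans (cong (k +_) (≡ᵇ⇒≡ x 0 u)) (+-identityʳ k))))))
    go false x t | inj₂ u = from (T-∨ {k + x ≡ᵇ r true}) (inj₂ (from (T-∨ {k + x ≡ᵇ k}) (inj₂ (from T-∨ (inj₁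
      (≡⇒≡ᵇ (k + x) (k + r false) (cong (k +_) (≡ᵇ⇒≡ x (r false) u))))))))

  -- Counting coloured parts.

  hit : Bool → Bool → Letter → ℕ
  hit b c (col q) = ind (sameB b c)
  hit b c (pl q)  = 0

  countB-encode : ∀ χ b p → (∀ st l → ind (p (part (χ st (quotient l)) l)) ≡ hit b (χ st (quotient l)) l) →
                  ∀ st w → countB p (encode χ st w) ≡ tally χ b st w
  countB-encode χ b p h st []          = refl
  countB-encode χ b p h st (col q ∷ w) = trans (countB-cons p _ (encode χ (not st) w))
    (cong₂ _+_ (h st (col q)) (countB-encode χ b p h (not st) w))
  countB-encode χ b p h st (pl q ∷ w)  = trans (countB-cons p _ (encode χ (not st) w))
    (cong₂ _+_ (h st (pl q)) (countB-encode χ b p h (not st) w))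

  hitA : ∀ b c l → ind (congB k (r b) (part c l)) ≡ hit b c l
  hitA b c (pl q) rewrite part-mod-pl c q | dec-false (0 ≟ r b) (<⇒≢ (r>0 b)) = refl
  hitA b c (col q) rewrite part-mod-col c q = cong ind (same b c)
    where
    same : ∀ b c → (r c ≡ᵇ r b) ≡ sameB b c
    same true  true  = dec-true (r true ≟ r true) refl
    same true  false = dec-false (r false ≟ r true) (≢-sym r≢r)
    same false true  = dec-false (r true ≟ r false) r≢r
    same false false = dec-true (r false ≟ r false) refl

  hitC : ∀ b l → ind (classC b (part (evenB (quotient l)) l)) ≡ hit b (evenB (quotient l)) l
  hitC b (pl q) rewrite mod-double (part (evenB (suc q)) (pl q)) | part-mod-pl (evenB (suc q)) q
    | part-div (evenB (suc q)) (pl q) = cong ind (miss b (evenB (suc q)))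
    where
    miss : ∀ b c → (lift c 0 ≡ᵇ (if b then r true else k + r false)) ≡ false
    miss true  true  = dec-false (0 ≟ r true) (<⇒≢ (r>0 true))
    miss false true  = refl
    miss true  false = dec-false (k + 0 ≟ r true) (>⇒≢ (<-≤-trans (r<k true) (m≤m+n k 0)))
    miss false false = dec-false (k + 0 ≟ k + r false) (<⇒≢ (+-monoʳ-< k (r>0 false)))
  hitC b (col q) rewrite mod-double (part (evenB q) (col q)) | part-mod-col (evenB q) q
    | part-div (evenB q) (col q) = cong ind (same b (evenB q))
    where
    same : ∀ b c → (lift c (r c) ≡ᵇ (if b then r true else k + r false)) ≡ sameB b c
    same true  true  = dec-true (r true ≟ r true) refl
    same false true  = dec-false (r true ≟ k + r false) (<⇒≢ (<-≤-trans (r<k true) (m≤m+n k (r false))))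
    same true  false = dec-false (k + r false ≟ r true) (>⇒≢ (<-≤-trans (r<k true) (m≤m+n k (r false))))
    same false false = dec-true (k + r false ≟ k + r false) refl

  -- The congruence conditions in their common form.

  oddEvenCond⇒Fits : ∀ π → T (oddEvenCond k m π) → Fits positionHue true π
  oddEvenCond⇒Fits []          t = tt
  oddEvenCond⇒Fits (a ∷ [])    t = t , tt
  oddEvenCond⇒Fits (a ∷ b ∷ l) t =
    proj₁ (to (T-∧ {fits true a}) t) , proj₁ (to (T-∧ {fits false b}) t′) ,
    oddEvenCond⇒Fits l (proj₂ (to (T-∧ {fits false b}) t′))
    where
    t′ : T (fits false b ∧ oddEvenCond k m l)
    t′ = proj₂ (to (T-∧ {fits true a}) t)

  Fits⇒oddEvenCond : ∀ π → Fits positionHue true π → T (oddEvenCond k m π)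
  Fits⇒oddEvenCond []          f           = tt
  Fits⇒oddEvenCond (a ∷ [])    (t , _)     = t
  Fits⇒oddEvenCond (a ∷ b ∷ l) (t , u , f) =
    from (T-∧ {fits true a}) (t , from (T-∧ {fits false b}) (u , Fits⇒oddEvenCond l f))

  allB⇒Fits : ∀ st π → T (allB condC π) → Fits quotientHue st π
  allB⇒Fits st []      t = tt
  allB⇒Fits st (a ∷ l) t =
    condC⇒fits a (proj₁ (to (T-∧ {condC a}) t)) , allB⇒Fits (not st) l (proj₂ (to (T-∧ {condC a}) t))

  Fits⇒allB : ∀ st π → Fits quotientHue st π → T (allB condC π)
  Fits⇒allB st []      f       = tt
  Fits⇒allB st (a ∷ l) (t , f) = from (T-∧ {condC a}) (fits⇒condC a t , Fits⇒allB (not st) l f)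

  -- Both kinds of partition as sorted lists of letters.

  -- Makes `encode` and `map decode` mutually inverse between the partitions in `P n` and the sorted
  -- lists of letters with encoded sum `n`; `class` gives the congruence class counted for each
  -- colour.
  record Model (S : Colouring) (P : ℕ → List ℕ → Bool) (class : Bool → ℕ → Bool) : Set where
    field
      encodes  : ∀ n π → T (P n π) → encode (hue S) true (map decode π) ≡ π
      sorted   : ∀ n π → T (P n π) → Sorted (map decode π)
      sums     : ∀ n π → T (P n π) → sum π ≡ n
      complete : ∀ n w → Sorted w → sum (encode (hue S) true w) ≡ n → T (P n (encode (hue S) true w))
      counts   : ∀ b w → countB (class b) (encode (hue S) true w) ≡ tally (hue S) b true w

  modelA : Model alternating (isA k m) (λ b → congB k (r b))
  modelA = record
    { encodes  = λ n π t → let d , _ , _ , f = parts n π t in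
        encode-decode positionHue true π d (oddEvenCond⇒Fits π f)
    ; sorted   = λ n π t → let d , _ , s , _ = parts n π t in
        decode-sorted π d (kStrict-separated π s)
    ; sums     = λ n π t → let _ , e , _ , _ = parts n π t in ≡ᵇ⇒≡ (sum π) n e
    ; complete = λ n w s e → let π = encode positionHue true w in
        from (T-∧ {strictDecr π}) (encode-strictDecr positionHue true w s ,
        from (T-∧ {sum π ≡ᵇ n}) (≡⇒≡ᵇ (sum π) n e ,
        from (T-∧ {kStrict k π}) (encode-kStrict positionHue true w s ,
        Fits⇒oddEvenCond π (Fits-encode positionHue true w))))
    ; counts   = λ b → countB-encode positionHue b _ (λ st l → hitA b st l) true
    }
    where
    parts : ∀ n π → T (isA k m n π) →
            T (strictDecr π) × T (sum π ≡ᵇ n) × T (kStrict k π) × T (oddEvenCond k m π)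
    parts n π t =
      let d , t₁ = to (T-∧ {strictDecr π}) t
          e , t₂ = to (T-∧ {sum π ≡ᵇ n}) t₁
      in d , e , to (T-∧ {kStrict k π}) t₂

  modelC : Model byQuotient (isC k m) classC
  modelC = record
    { encodes  = λ n π t → let d , _ , f = parts n π t in
        encode-decode quotientHue true π d (allB⇒Fits true π f)
    ; sorted   = λ n π t → let d , _ , f = parts n π t in
        decode-sorted π d (Fits-separated true π d (allB⇒Fits true π f))
    ; sums     = λ n π t → let _ , e , _ = parts n π t in ≡ᵇ⇒≡ (sum π) n e
    ; complete = λ n w s e → let π = encode quotientHue true w in
        from (T-∧ {strictDecr π}) (encode-strictDecr quotientHue true w s ,
        from (T-∧ {sum π ≡ᵇ n}) (≡⇒≡ᵇ (sum π) n e ,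
        Fits⇒allB true π (Fits-encode quotientHue true w)))
    ; counts   = λ b → countB-encode quotientHue b _ (λ _ l → hitC b l) true
    }
    where
    parts : ∀ n π → T (isC k m n π) → T (strictDecr π) × T (sum π ≡ᵇ n) × T (allB condC π)
    parts n π t = let d , t₁ = to (T-∧ {strictDecr π}) t in d , to (T-∧ {sum π ≡ᵇ n}) t₁

  -- The bijection between the two kinds.

  translate : Colouring → Colouring → ℕ → List ℕ → List ℕ
  translate S T n π = encode (hue T) true (convertLetters S T n (map decode π))

  module _ {S U P Q p q} (M : Model S P p) (N : Model U Q q) (n : ℕ) (π : List ℕ) (t : T (P n π)) where

    open Model

    private
      w = map decode π

      size : weight w + coloured w ≤ n
      size = subst (weight w + coloured w ≤_)
        (trans (cong sum (encodes M n π t)) (sums M n π t)) (weight+coloured≤sum (hue S) true w)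

      below : BelowO n w
      below = BelowO-weight w (m+n≤o⇒m≤o (weight w) size) (sorted M n π t)

      tallies : ∀ b → tally (hue U) b true (convertLetters S U n w) ≡ tally (hue S) b true w
      tallies = convertLetters-tally S U n w below size

    translate-valid : T (Q n (translate S U n π))
    translate-valid = complete N n _ (convertLetters-sorted S U n w below) (begin
      sum (translate S U n π)
        ≡⟨ sum-encode (hue U) true (convertLetters S U n w) ⟩
      _ ≡⟨ cong₂ (λ x y → x * k + y) (convertLetters-weight S U n w below)
             (cong₂ (λ x y → r true * x + r false * y) (tallies true) (tallies false)) ⟩
      _ ≡⟨ sum-encode (hue S) true w ⟨
      sum (encode (hue S) true w)
        ≡⟨ cong sum (encodes M n π t) ⟩
      sum π ≡⟨ sums M n π t ⟩
      n ∎)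
      where open ≡-Reasoning

    translate-count : ∀ b → countB (q b) (translate S U n π) ≡ countB (p b) π
    translate-count b = trans (counts N b (convertLetters S U n w)) (trans (tallies b)
      (trans (sym (counts M b w)) (cong (countB (p b)) (encodes M n π t))))

    translate-inverse : translate U S n (translate S U n π) ≡ π
    translate-inverse = begin
      encode (hue S) true (convertLetters U S n (map decode (translate S U n π)))
        ≡⟨ cong (λ v → encode (hue S) true (convertLetters U S n v)) (decode-encode (hue U) true (convertLetters S U n w)) ⟩
      encode (hue S) true (convertLetters U S n (convertLetters S U n w))
        ≡⟨ cong (encode (hue S) true) (convertLetters-inverse S U n w below (m+n≤o⇒m≤o (weight w) size)) ⟩
      encode (hue S) true w
        ≡⟨ encodes M n π t ⟩
      π ∎
      where open ≡-Reasoning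

  -- `A` and `B` may carry further conditions beyond `P n` and `Q n`, so the refined and the total
  -- statement are both instances.
  bijection : ∀ {S U P Q p q} → Model S P p → Model U Q q → ∀ n (A B : List ℕ → Bool) →
    (∀ π → T (A π) → T (P n π)) → (∀ π → T (A π) → T (B (translate S U n π))) →
    (∀ π → T (B π) → T (Q n π)) → (∀ π → T (B π) → T (A (translate U S n π))) →
    Σ (List ℕ) (λ π → T (A π)) ↔ Σ (List ℕ) (λ π → T (B π))
  bijection M N n A B A⇒P A⇒B B⇒Q B⇒A = mk↔ₛ′
    (λ (π , t) → _ , A⇒B π t)
    (λ (π , t) → _ , B⇒A π t)
    (λ (π , t) → Σ-≡ B (translate-inverse N M n π (B⇒Q π t)))
    (λ (π , t) → Σ-≡ A (translate-inverse M N n π (A⇒P π t)))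
    where
    -- `T` of a Boolean has at most one proof, so only the lists need to agree.
    Σ-≡ : ∀ (C : List ℕ → Bool) {x y : Σ (List ℕ) λ π → T (C π)} → proj₁ x ≡ proj₁ y → x ≡ y
    Σ-≡ C refl = cong (_ ,_) (T-irrelevant _ _)

  counted : (Bool → ℕ → Bool) → ℕ → ℕ → List ℕ → Bool
  counted class i j π = (countB (class true) π ≡ᵇ i) ∧ (countB (class false) π ≡ᵇ j)

  translate-counted : ∀ {S U P Q p q} → Model S P p → Model U Q q → ∀ n i j π →
    T (P n π ∧ counted p i j π) →
    T (Q n (translate S U n π) ∧ counted q i j (translate S U n π))
  translate-counted {P = P} {Q} {p} {q} M N n i j π t = from (T-∧ {Q n _})
    ( translate-valid M N n π t₁
    , subst T (sym (cong₂ (λ x y → (x ≡ᵇ i) ∧ (y ≡ᵇ j))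
        (translate-count M N n π t₁ true) (translate-count M N n π t₁ false))) (proj₂ (to (T-∧ {P n π}) t)))
    where
    t₁ : T (P n π)
    t₁ = proj₁ (to (T-∧ {P n π}) t)

  refined : ∀ n i j → Aset k m n i j ↔ Cset k m n i j
  refined n i j = bijection modelA modelC n _ _
    (λ π t → proj₁ (to (T-∧ {isA k m n π}) t)) (translate-counted modelA modelC n i j)
    (λ π t → proj₁ (to (T-∧ {isC k m n π}) t)) (translate-counted modelC modelA n i j)

  unrefined : ∀ n → AsetAll k m n ↔ CsetAll k m n
  unrefined n = bijection modelA modelC n _ _
    (λ _ t → t) (translate-valid modelA modelC n)
    (λ _ t → t) (translate-valid modelC modelA n)

theorem2p8 : (k m : ℕ) → 3 ≤ k → (m ≡ 1 ⊎ m ≡ 2) →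
    ((n i j : ℕ) → Aset k m n i j ↔ Cset k m n i j)
    × ((n : ℕ) → AsetAll k m n ↔ CsetAll k m n)
theorem2p8 (suc k₀) m 3≤k m∈ = refined , unrefined
  where
  -- The residues are 1 and 2 in one order or the other, and `3 ≤ k` puts both below `k`.
  bounds : m ≡ 1 ⊎ m ≡ 2 → ∀ b → 0 < residue m b × residue m b < suc k₀
  bounds (inj₁ refl) true  = s≤s z≤n , 3≤k
  bounds (inj₁ refl) false = s≤s z≤n , ≤-trans (n≤1+n 2) 3≤k
  bounds (inj₂ refl) true  = s≤s z≤n , ≤-trans (n≤1+n 2) 3≤k
  bounds (inj₂ refl) false = s≤s z≤n , 3≤k

  distinct : m ≡ 1 ⊎ m ≡ 2 → residue m true ≢ residue m false
  distinct (inj₁ refl) ()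
  distinct (inj₂ refl) ()

  open Parts k₀ m (λ b → proj₁ (bounds m∈ b)) (λ b → proj₂ (bounds m∈ b)) (distinct m∈)
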